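{- Danzer's configuration $(35_4)$ can be decomposed into an incidence sum $\mathcal C_1\oplus_I\mathcal C_2$ where $\mathcal C_1$ is the Steiner–Plücker configuration $(20_3,15_4)$ and $\mathcal C_2$ is the Cayley–Salmon configuration $(15_4,20_3)$.
   Context: Danzer's configuration $(35_4)$: its points are the $35$ points in which four, and its lines the $35$ lines in which three, of seven hyperplanes in general position in projective $4$-space meet, with the incidence of projective space; combinatorially, points are the $4$-subsets and lines the $3$-subsets of a $7$-set, incidence being containment. The Steiner–Plücker configuration $(20_3,15_4)$: for three triangles in the projective plane pairwise perspective from the same point $O$ (whose three axes of perspectivity then concur at a point $Z$), its points are $O$, the $9$ vertices, the $9$ intersection points of corresponding sides of the three pairs of triangles, and $Z$; its lines are the $3$ lines through $O$ joining corresponding vertices, the $9$ sides, and the $3$ axes. The Cayley–Salmon configuration $(15_4,20_3)$: for three triangles pairwise perspective from the same line $\ell$ (whose three centres of perspectivity then lie on a line $m$), its points are the $9$ vertices, the $3$ points on $\ell$ where corresponding sides meet, and the $3$ centres; its lines are $\ell$, the $9$ sides, the $9$ lines joining corresponding vertices of the three pairs, and $m$. Incidence sum: for configurations $\mathcal C_1,\mathcal C_2$ with point sets $\mathcal P_i$ and line sets $\mathcal L_i$ and $I\subseteq(\mathcal P_1\times\mathcal L_2)\cup(\mathcal P_2\times\mathcal L_1)$, $\mathcal C_1\oplus_I\mathcal C_2$ is the incidence structure on points $\mathcal P_1\sqcup\mathcal P_2$ and lines $\mathcal L_1\sqcup\mathcal L_2$ whose incidences are those of $\mathcal C_1$, of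 $\mathcal C_2$, and the pairs of $I$. "Decomposed" means Danzer's configuration is isomorphic to such an incidence sum for some $I$. -}

module Defs where

open import Data.Bool using (Bool; true; false; _∧_; not)
open import Data.Nat using (ℕ)
open import Data.Fin using (Fin)
open import Data.Fin.Properties using (_≟_)
open import Data.Fin.Subset using (Subset; ∣_∣)
open import Data.Fin.Subset.Properties using (_⊆?_)
open import Data.Product using (Σ; _×_; proj₁)
open import Data.Sum using (_⊎_; inj₁; inj₂)
open import Function using (_⤖_; Bijection)
open import Relation.Nullary.Decidable using (⌊_⌋)
open import Relation.Binary.PropositionalEquality using (_≡_)

record IncStr : Set₁ where
  field
    Pt  : Set
    Ln  : Set
    inc : Pt → Ln → Bool
open IncStr public

record _≅_ (C D : IncStr) : Set where
  field
    onPt  : Pt C ⤖ Pt D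
    onLn  : Ln C ⤖ Ln D
    presv : ∀ p l → inc D (Bijection.to onPt p) (Bijection.to onLn l) ≡ inc C p l

-- Incidence sum C₁ ⊕_I C₂ ; I ⊆ (P₁ × L₂) ∪ (P₂ × L₁) is given as the pair of
-- characteristic functions (I₁₂ , I₂₁).
incSum : (C₁ C₂ : IncStr) → (Pt C₁ → Ln C₂ → Bool) → (Pt C₂ → Ln C₁ → Bool) → IncStr
incSum C₁ C₂ I₁₂ I₂₁ = record { Pt = Pt C₁ ⊎ Pt C₂ ; Ln = Ln C₁ ⊎ Ln C₂ ; inc = i }
  where
  i : Pt C₁ ⊎ Pt C₂ → Ln C₁ ⊎ Ln C₂ → Bool
  i (inj₁ p) (inj₁ l) = inc C₁ p l
  i (inj₁ p) (inj₂ l) = I₁₂ p l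
  i (inj₂ p) (inj₁ l) = I₂₁ p l
  i (inj₂ p) (inj₂ l) = inc C₂ p l

_==_ : Fin 3 → Fin 3 → Bool
i == j = ⌊ i ≟ j ⌋

Danzer : IncStr
Danzer = record
  { Pt  = Σ (Subset 7) (λ s → ∣ s ∣ ≡ 4)
  ; Ln  = Σ (Subset 7) (λ s → ∣ s ∣ ≡ 3)
  ; inc = λ p l → ⌊ proj₁ l ⊆? proj₁ p ⌋ }

-- Steiner–Plücker configuration (20_3, 15_4).
-- Triangles t ∈ Fin 3; vertex A t j lies on the j-th line through O;
-- side t k of triangle t is the side opposite A t k;
-- a pair of triangles {t,t'} is coded by the third index p ∉ {t,t'};
-- B p k = intersection of the k-th sides of the two triangles of pair p;
-- axis p = axis of perspectivity of pair p; Z = common point of the axes.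

data SPPt : Set where
  O : SPPt
  A : Fin 3 → Fin 3 → SPPt
  B : Fin 3 → Fin 3 → SPPt
  Z : SPPt

data SPLn : Set where
  throughO : Fin 3 → SPLn
  side     : Fin 3 → Fin 3 → SPLn
  axis     : Fin 3 → SPLn

spInc : SPPt → SPLn → Bool
spInc O       (throughO j)  = true
spInc (A t j) (throughO j') = j == j'
spInc (A t j) (side t' k)   = (t == t') ∧ not (j == k)
spInc (B p k) (side t k')   = not (p == t) ∧ (k == k')
spInc (B p k) (axis p')     = p == p'
spInc Z       (axis p)      = true
spInc _       _             = false

SteinerPlucker : IncStr
SteinerPlucker = record { Pt = SPPt ; Ln = SPLn ; inc = spInc }

-- Cayley–Salmon configuration (15_4, 20_3).
-- Triangles t ∈ Fin 3; side t k of triangle t (k-th sides correspond and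
-- meet ℓ in the point C k); vertex V t j = side t k ∩ side t l, {j,k,l} = Fin 3
-- (so V t j is opposite side t j, and V t j, V t' j correspond);
-- pair {t,t'} coded by the third index p; join p j = line joining the j-th
-- vertices of the two triangles of pair p; D p = centre of perspectivity of
-- pair p; ℓ = ell, m = the line through the three centres.

data CSPt : Set where
  V : Fin 3 → Fin 3 → CSPt
  C : Fin 3 → CSPt
  D : Fin 3 → CSPt

data CSLn : Set where
  ell  : CSLn
  side : Fin 3 → Fin 3 → CSLn
  join : Fin 3 → Fin 3 → CSLn
  m    : CSLn

csInc : CSPt → CSLn → Bool
csInc (C k)   ell          = true
csInc (V t j) (side t' k)  = (t == t') ∧ not (j == k)
csInc (C k)   (side t k')  = k == k'
csInc (V t j) (join p j')  = not (t == p) ∧ (j == j')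
csInc (D p)   (join p' j)  = p == p'
csInc (D p)   m            = true
csInc _       _            = false

CayleySalmon : IncStr
CayleySalmon = record { Pt = CSPt ; Ln = CSLn ; inc = csInc }

{-# OPTIONS --safe #-}

-- Mark one element of the 7-set and split the other six into two triples α and β.
-- The 4-subsets and 3-subsets containing the marked element are the triples and
-- pairs of the 6-set α ∪ β and form the Steiner–Plücker configuration; those
-- avoiding it form the Cayley–Salmon configuration. A subset of a triple is empty,
-- a singleton, the complement of a singleton, or everything, and in these terms the
-- labels of the two configurations can be read off so that containment matches the
-- given incidences.
module Submission where

open import Defs
open import Data.Bool using (Bool; true; false; _∧_; not)
open import Data.Bool.Properties using (∧-identityʳ) renaming (_≟_ to _≟ᵇ_)
open import Data.Fin using (Fin)
open import Data.Fin.Patterns using (0F; 1F; 2F)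
open import Data.Fin.Subset using (Subset; inside; outside; ⊥; ⊤; ⁅_⁆; ∁; ∣_∣)
open import Data.Fin.Subset.Properties using (_⊆?_; anySubset?)
open import Data.Nat using (ℕ; suc; _+_)
open import Data.Nat.Properties using (≡-irrelevant)
open import Data.Product using (Σ; _×_; _,_; proj₁)
open import Data.Product.Properties using (Σ-≡,≡→≡)
open import Data.Sum using (_⊎_; inj₁; inj₂)
open import Data.Vec using ([]; _∷_; _++_)
open import Function using (_∘_; _↔_; mk↔ₛ′)
open import Function.Properties.Inverse using (↔⇒⤖)
open import Relation.Nullary.Decidable
  using (Dec; ⌊_⌋; ¬?; map′; decidable-stable; from-yes; ⌊⌋-map′)
open import Relation.Unary using (Pred; Decidable)
open import Relation.Binary.PropositionalEquality
  using (_≡_; refl; sym; trans; cong; cong₂)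

-- Containment and size of concatenated subsets.

allSubset? : ∀ {n p} {P : Pred (Subset n) p} → Decidable P → Dec (∀ s → P s)
allSubset? P? = map′
  (λ ∄¬P s → decidable-stable (P? s) (λ ¬Ps → ∄¬P (s , ¬Ps)))
  (λ ∀P (s , ¬Ps) → ¬Ps (∀P s))
  (¬? (anySubset? (¬? ∘ P?)))

-- After equal heads `_⊆?_` is a `map′` of the decision on the tails, which `⌊⌋-map′` strips;
-- likewise when the left head is `outside`. A failing head makes both sides `false`.
⊆?-++ : ∀ {k n} (p q : Subset k) (r s : Subset n) →
        ⌊ p ++ r ⊆? q ++ s ⌋ ≡ ⌊ p ⊆? q ⌋ ∧ ⌊ r ⊆? s ⌋
⊆?-++ [] [] r s = refl
⊆?-++ (outside ∷ p) (y ∷ q) r s =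
  trans (⌊⌋-map′ _ _ (p ++ r ⊆? q ++ s))
    (trans (⊆?-++ p q r s) (cong (_∧ ⌊ r ⊆? s ⌋) (sym (⌊⌋-map′ _ _ (p ⊆? q)))))
⊆?-++ (inside ∷ p) (outside ∷ q) r s = refl
⊆?-++ (inside ∷ p) (inside ∷ q) r s =
  trans (⌊⌋-map′ _ _ (p ++ r ⊆? q ++ s))
    (trans (⊆?-++ p q r s) (cong (_∧ ⌊ r ⊆? s ⌋) (sym (⌊⌋-map′ _ _ (p ⊆? q)))))

∣++∣ : ∀ {k n} (p : Subset k) (q : Subset n) → ∣ p ++ q ∣ ≡ ∣ p ∣ + ∣ q ∣
∣++∣ []            q = refl
∣++∣ (outside ∷ p) q = ∣++∣ p q
∣++∣ (inside ∷ p)  q = cong suc (∣++∣ p q)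

-- The eight subsets of a triple.

data Part : Set where
  none all  : Part
  only omit : Fin 3 → Part

⟦_⟧ : Part → Subset 3
⟦ none ⟧   = ⊥
⟦ all ⟧    = ⊤
⟦ only i ⟧ = ⁅ i ⁆
⟦ omit i ⟧ = ∁ ⁅ i ⁆

classify : Subset 3 → Part
classify (false ∷ false ∷ false ∷ []) = none
classify (true  ∷ false ∷ false ∷ []) = only 0F
classify (false ∷ true  ∷ false ∷ []) = only 1F
classify (false ∷ false ∷ true  ∷ []) = only 2F
classify (false ∷ true  ∷ true  ∷ []) = omit 0F
classify (true  ∷ false ∷ true  ∷ []) = omit 1F
classify (true  ∷ true  ∷ false ∷ []) = omit 2F
classify (true  ∷ true  ∷ true  ∷ []) = all

classify-⟦⟧ : ∀ π → classify ⟦ π ⟧ ≡ π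
classify-⟦⟧ none      = refl
classify-⟦⟧ all       = refl
classify-⟦⟧ (only 0F) = refl
classify-⟦⟧ (only 1F) = refl
classify-⟦⟧ (only 2F) = refl
classify-⟦⟧ (omit 0F) = refl
classify-⟦⟧ (omit 1F) = refl
classify-⟦⟧ (omit 2F) = refl

⟦⟧-classify : ∀ s → ⟦ classify s ⟧ ≡ s
⟦⟧-classify (false ∷ false ∷ false ∷ []) = refl
⟦⟧-classify (true  ∷ false ∷ false ∷ []) = refl
⟦⟧-classify (false ∷ true  ∷ false ∷ []) = refl
⟦⟧-classify (false ∷ false ∷ true  ∷ []) = refl
⟦⟧-classify (false ∷ true  ∷ true  ∷ []) = refl
⟦⟧-classify (true  ∷ false ∷ true  ∷ []) = refl
⟦⟧-classify (true  ∷ true  ∷ false ∷ []) = refl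
⟦⟧-classify (true  ∷ true  ∷ true  ∷ []) = refl

size : Part → ℕ
size none     = 0
size (only _) = 1
size (omit _) = 2
size all      = 3

∣⟦_⟧∣ : ∀ π → ∣ ⟦ π ⟧ ∣ ≡ size π
∣⟦ none ⟧∣    = refl
∣⟦ all ⟧∣     = refl
∣⟦ only 0F ⟧∣ = refl
∣⟦ only 1F ⟧∣ = refl
∣⟦ only 2F ⟧∣ = refl
∣⟦ omit 0F ⟧∣ = refl
∣⟦ omit 1F ⟧∣ = refl
∣⟦ omit 2F ⟧∣ = refl

-- The index of the larger set comes first in each comparison, as `spInc` and `csInc` compare the
-- point's index with the line's.
_⊑_ : Part → Part → Bool
none   ⊑ _      = true
only _ ⊑ none   = false
only i ⊑ only j = j == i
only i ⊑ omit j = not (j == i)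
only _ ⊑ all    = true
omit _ ⊑ none   = false
omit _ ⊑ only _ = false
omit i ⊑ omit j = j == i
omit _ ⊑ all    = true
all    ⊑ all    = true
all    ⊑ _      = false

-- Decided by evaluating all 64 pairs of subsets; `⊆?-⟦⟧` then carries it over to parts whose
-- indices are variables.
⊆?-classify : ∀ s t → ⌊ s ⊆? t ⌋ ≡ classify s ⊑ classify t
⊆?-classify = from-yes (allSubset? λ s → allSubset? λ t →
  ⌊ s ⊆? t ⌋ ≟ᵇ (classify s ⊑ classify t))

⊆?-⟦⟧ : ∀ π ρ → ⌊ ⟦ π ⟧ ⊆? ⟦ ρ ⟧ ⌋ ≡ π ⊑ ρ
⊆?-⟦⟧ π ρ = trans (⊆?-classify ⟦ π ⟧ ⟦ ρ ⟧) (cong₂ _⊑_ (classify-⟦⟧ π) (classify-⟦⟧ ρ))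

-- (x , β , α): whether the marked element is present, then the parts of the triples
-- β and α. With β first, the conjunctions in spInc and csInc agree definitionally
-- with containment of codes, up to a trailing true.
Code : Set
Code = Bool × Part × Part

toSubset : Code → Subset 7
toSubset (x , β , α) = x ∷ ⟦ β ⟧ ++ ⟦ α ⟧

fromSubset : Subset 7 → Code
fromSubset (x ∷ b₀ ∷ b₁ ∷ b₂ ∷ s) = x , classify (b₀ ∷ b₁ ∷ b₂ ∷ []) , classify s

fromSubset-++ : ∀ x (s t : Subset 3) →
                fromSubset (x ∷ s ++ t) ≡ (x , classify s , classify t)
fromSubset-++ x (_ ∷ _ ∷ _ ∷ []) t = refl

fromSubset-toSubset : ∀ c → fromSubset (toSubset c) ≡ c
fromSubset-toSubset (x , β , α) = trans (fromSubset-++ x ⟦ β ⟧ ⟦ α ⟧)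
  (cong₂ (λ β′ α′ → x , β′ , α′) (classify-⟦⟧ β) (classify-⟦⟧ α))

toSubset-fromSubset : ∀ s → toSubset (fromSubset s) ≡ s
toSubset-fromSubset (x ∷ b₀ ∷ b₁ ∷ b₂ ∷ s) =
  cong₂ (λ t u → x ∷ t ++ u) (⟦⟧-classify (b₀ ∷ b₁ ∷ b₂ ∷ [])) (⟦⟧-classify s)

weight : Code → ℕ
weight (false , β , α) = size β + size α
weight (true  , β , α) = suc (size β + size α)

∣toSubset∣ : ∀ c → ∣ toSubset c ∣ ≡ weight c
∣toSubset∣ (false , β , α) = trans (∣++∣ ⟦ β ⟧ ⟦ α ⟧) (cong₂ _+_ ∣⟦ β ⟧∣ ∣⟦ α ⟧∣)
∣toSubset∣ (true  , β , α) = cong suc (∣toSubset∣ (false , β , α))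

weight-fromSubset : ∀ s → weight (fromSubset s) ≡ ∣ s ∣
weight-fromSubset s =
  trans (sym (∣toSubset∣ (fromSubset s))) (cong ∣_∣ (toSubset-fromSubset s))

_⊑ᵇ_ : Bool → Bool → Bool
true  ⊑ᵇ y = y
false ⊑ᵇ _ = true

_⊑ᶜ_ : Code → Code → Bool
(x , β , α) ⊑ᶜ (y , δ , γ) = (x ⊑ᵇ y) ∧ ((β ⊑ δ) ∧ (α ⊑ γ))

⊆?-toSubset : ∀ c d → ⌊ toSubset c ⊆? toSubset d ⌋ ≡ c ⊑ᶜ d
⊆?-toSubset (x , β , α) (y , δ , γ) =
  -- The marked coordinate counts as a subset of a one-element set, so the splitting lemma, used
  -- twice, cuts 7 into 1 + 3 + 3.
  trans (⊆?-++ (x ∷ []) (y ∷ []) (⟦ β ⟧ ++ ⟦ α ⟧) (⟦ δ ⟧ ++ ⟦ γ ⟧))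
    (cong₂ _∧_ (head x y)
      (trans (⊆?-++ ⟦ β ⟧ ⟦ δ ⟧ ⟦ α ⟧ ⟦ γ ⟧) (cong₂ _∧_ (⊆?-⟦⟧ β δ) (⊆?-⟦⟧ α γ))))
  where
  head : ∀ x y → ⌊ x ∷ [] ⊆? y ∷ [] ⌋ ≡ x ⊑ᵇ y
  head false _     = refl
  head true  false = refl
  head true  true  = refl

-- Names for the subsets of a fixed size.

record Labelling (n : ℕ) (X : Set) : Set where
  field
    label         : X → Code
    weight-label  : ∀ x → weight (label x) ≡ n
    unlabel       : ∀ c → weight c ≡ n → X
    label-unlabel : ∀ c h → label (unlabel c h) ≡ c
    unlabel-label : ∀ x h → unlabel (label x) h ≡ x

  -- A code read back from a subset equals the label only propositionally; with `c` a variable,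
  -- matching on the equation avoids transporting `h`.
  unlabel-≡ : ∀ {c x} h → c ≡ label x → unlabel c h ≡ x
  unlabel-≡ {x = x} h refl = unlabel-label x h

  decode : Σ (Subset 7) (λ s → ∣ s ∣ ≡ n) → X
  decode (s , h) = unlabel (fromSubset s) (trans (weight-fromSubset s) h)

  encode : X → Σ (Subset 7) (λ s → ∣ s ∣ ≡ n)
  encode x = toSubset (label x) , trans (∣toSubset∣ (label x)) (weight-label x)

  toSubset-label-decode : ∀ s → toSubset (label (decode s)) ≡ proj₁ s
  toSubset-label-decode (s , _) =
    trans (cong toSubset (label-unlabel (fromSubset s) _)) (toSubset-fromSubset s)

  decode-↔ : Σ (Subset 7) (λ s → ∣ s ∣ ≡ n) ↔ X
  decode-↔ = mk↔ₛ′ decode encode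
    (λ x → unlabel-≡ _ (fromSubset-toSubset (label x)))
    -- Proofs of an equation in `ℕ` are unique, so only the subsets need comparing.
    (λ s → Σ-≡,≡→≡ (toSubset-label-decode s , ≡-irrelevant _ _))

-- Labels of points and lines.

points : Labelling 4 (SPPt ⊎ CSPt)
points = record
  { label         = label
  ; weight-label  = weight-label
  ; unlabel       = unlabel
  ; label-unlabel = label-unlabel
  ; unlabel-label = unlabel-label
  }
  where
  -- A meeting point is a union of lines: `B p k` unites the k-th sides of the two triangles indexed
  -- by `omit p`, and `V t j` the two sides of triangle `t` other than the j-th.
  label : SPPt ⊎ CSPt → Code
  label (inj₁ O)       = true  , none   , all
  label (inj₁ (A t j)) = true  , only t , omit j
  label (inj₁ (B p k)) = true  , omit p , only k
  label (inj₁ Z)       = true  , all    , none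
  label (inj₂ (V t j)) = false , omit t , omit j
  label (inj₂ (C k))   = false , all    , only k
  label (inj₂ (D p))   = false , only p , all

  weight-label : ∀ x → weight (label x) ≡ 4
  weight-label (inj₁ O)       = refl
  weight-label (inj₁ (A _ _)) = refl
  weight-label (inj₁ (B _ _)) = refl
  weight-label (inj₁ Z)       = refl
  weight-label (inj₂ (V _ _)) = refl
  weight-label (inj₂ (C _))   = refl
  weight-label (inj₂ (D _))   = refl

  -- `size` ignores indices, so each shape has a numeral as weight. The seven kept shapes split 3
  -- between the triples beside the marked element, or 4 without it.
  unlabel : ∀ c → weight c ≡ 4 → SPPt ⊎ CSPt
  unlabel (true  , none   , all)    refl = inj₁ O
  unlabel (true  , only t , omit j) refl = inj₁ (A t j)
  unlabel (true  , omit p , only k) refl = inj₁ (B p k)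
  unlabel (true  , all    , none)   refl = inj₁ Z
  unlabel (false , omit t , omit j) refl = inj₂ (V t j)
  unlabel (false , all    , only k) refl = inj₂ (C k)
  unlabel (false , only p , all)    refl = inj₂ (D p)
  unlabel (false , none   , none)   ()

  label-unlabel : ∀ c h → label (unlabel c h) ≡ c
  label-unlabel (true  , none   , all)    refl = refl
  label-unlabel (true  , only _ , omit _) refl = refl
  label-unlabel (true  , omit _ , only _) refl = refl
  label-unlabel (true  , all    , none)   refl = refl
  label-unlabel (false , omit _ , omit _) refl = refl
  label-unlabel (false , all    , only _) refl = refl
  label-unlabel (false , only _ , all)    refl = refl
  label-unlabel (false , none   , none)   ()

  unlabel-label : ∀ x h → unlabel (label x) h ≡ x
  unlabel-label (inj₁ O)       refl = refl
  unlabel-label (inj₁ (A _ _)) refl = refl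
  unlabel-label (inj₁ (B _ _)) refl = refl
  unlabel-label (inj₁ Z)       refl = refl
  unlabel-label (inj₂ (V _ _)) refl = refl
  unlabel-label (inj₂ (C _))   refl = refl
  unlabel-label (inj₂ (D _))   refl = refl

lines : Labelling 3 (SPLn ⊎ CSLn)
lines = record
  { label         = label
  ; weight-label  = weight-label
  ; unlabel       = unlabel
  ; label-unlabel = label-unlabel
  ; unlabel-label = unlabel-label
  }
  where
  -- A joining line is an intersection of points: `axis p` of the three `B p k`, and `join p j` of
  -- the two `V t j` with `t` different from `p`.
  label : SPLn ⊎ CSLn → Code
  label (inj₁ (throughO j)) = true  , none   , omit j
  label (inj₁ (side t k))   = true  , only t , only k
  label (inj₁ (axis p))     = true  , omit p , none
  label (inj₂ ell)          = false , all    , none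
  label (inj₂ (side t k))   = false , omit t , only k
  label (inj₂ (join p j))   = false , only p , omit j
  label (inj₂ m)            = false , none   , all

  weight-label : ∀ x → weight (label x) ≡ 3
  weight-label (inj₁ (throughO _)) = refl
  weight-label (inj₁ (side _ _))   = refl
  weight-label (inj₁ (axis _))     = refl
  weight-label (inj₂ ell)          = refl
  weight-label (inj₂ (side _ _))   = refl
  weight-label (inj₂ (join _ _))   = refl
  weight-label (inj₂ m)            = refl

  unlabel : ∀ c → weight c ≡ 3 → SPLn ⊎ CSLn
  unlabel (true  , none   , omit j) refl = inj₁ (throughO j)
  unlabel (true  , only t , only k) refl = inj₁ (side t k)
  unlabel (true  , omit p , none)   refl = inj₁ (axis p)
  unlabel (false , all    , none)   refl = inj₂ ell
  unlabel (false , omit t , only k) refl = inj₂ (side t k)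
  unlabel (false , only p , omit j) refl = inj₂ (join p j)
  unlabel (false , none   , all)    refl = inj₂ m

  label-unlabel : ∀ c h → label (unlabel c h) ≡ c
  label-unlabel (true  , none   , omit _) refl = refl
  label-unlabel (true  , only _ , only _) refl = refl
  label-unlabel (true  , omit _ , none)   refl = refl
  label-unlabel (false , all    , none)   refl = refl
  label-unlabel (false , omit _ , only _) refl = refl
  label-unlabel (false , only _ , omit _) refl = refl
  label-unlabel (false , none   , all)    refl = refl

  unlabel-label : ∀ x h → unlabel (label x) h ≡ x
  unlabel-label (inj₁ (throughO _)) refl = refl
  unlabel-label (inj₁ (side _ _))   refl = refl
  unlabel-label (inj₁ (axis _))     refl = refl
  unlabel-label (inj₂ ell)          refl = refl
  unlabel-label (inj₂ (side _ _))   refl = refl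
  unlabel-label (inj₂ (join _ _))   refl = refl
  unlabel-label (inj₂ m)            refl = refl

open Labelling

-- Incidence as containment of codes.

contains : SPPt ⊎ CSPt → SPLn ⊎ CSLn → Bool
contains p l = label lines l ⊑ᶜ label points p

contains-sp : ∀ p l → contains (inj₁ p) (inj₁ l) ≡ spInc p l
contains-sp O       (throughO _) = refl
contains-sp O       (side _ _)   = refl
contains-sp O       (axis _)     = refl
contains-sp (A _ _) (throughO _) = refl
contains-sp (A _ _) (side _ _)   = refl
contains-sp (A _ _) (axis _)     = refl
contains-sp (B _ _) (throughO _) = refl
contains-sp (B _ _) (side _ _)   = refl
-- The factor for the triple α is a trailing `true`, and `_∧_` computes on its left argument.
contains-sp (B _ _) (axis _)     = ∧-identityʳ _
contains-sp Z       (throughO _) = refl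
contains-sp Z       (side _ _)   = refl
contains-sp Z       (axis _)     = refl

contains-cs : ∀ p l → contains (inj₂ p) (inj₂ l) ≡ csInc p l
contains-cs (V _ _) ell        = refl
contains-cs (V _ _) (side _ _) = refl
contains-cs (V _ _) (join _ _) = refl
contains-cs (V _ _) m          = refl
contains-cs (C _)   ell        = refl
contains-cs (C _)   (side _ _) = refl
contains-cs (C _)   (join _ _) = refl
contains-cs (C _)   m          = refl
contains-cs (D _)   ell        = refl
contains-cs (D _)   (side _ _) = refl
contains-cs (D _)   (join _ _) = ∧-identityʳ _
contains-cs (D _)   m          = refl

theorem4p8 : Σ (Pt SteinerPlucker → Ln CayleySalmon → Bool) λ I₁₂ →
    Σ (Pt CayleySalmon → Ln SteinerPlucker → Bool) λ I₂₁ →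
    Danzer ≅ incSum SteinerPlucker CayleySalmon I₁₂ I₂₁
theorem4p8 = I₁₂ , I₂₁ , record
  { onPt  = ↔⇒⤖ (decode-↔ points)
  ; onLn  = ↔⇒⤖ (decode-↔ lines)
  ; presv = λ p l → trans (sym (contains-sum (decode points p) (decode lines l)))
      (trans
        (sym (⊆?-toSubset (label lines (decode lines l)) (label points (decode points p))))
        (cong₂ (λ s t → ⌊ s ⊆? t ⌋)
          (toSubset-label-decode lines l) (toSubset-label-decode points p)))
  }
  where
  -- Without the marked element the point has three elements, so incidence means equal parts: `O`
  -- lies on `m`, `A t j` on `join t j`, `B p k` on `side p k`, `Z` on `ell`, and nothing else.
  I₁₂ : SPPt → CSLn → Bool
  I₁₂ p l = contains (inj₁ p) (inj₂ l)

  -- Identically `false`: these lines contain the marked element and these points avoid it.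
  I₂₁ : CSPt → SPLn → Bool
  I₂₁ p l = contains (inj₂ p) (inj₁ l)

  contains-sum : ∀ p l →
                 contains p l ≡ inc (incSum SteinerPlucker CayleySalmon I₁₂ I₂₁) p l
  contains-sum (inj₁ p) (inj₁ l) = contains-sp p l
  contains-sum (inj₁ _) (inj₂ _) = refl
  contains-sum (inj₂ _) (inj₁ _) = refl
  contains-sum (inj₂ p) (inj₂ l) = contains-cs p l
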